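{- If $G$ is a $C$-expander for some $C\ge3$ and $|V(G)|$ is even, then $G$ contains a perfect matching.
   Context: For a graph $G$ and $X\subseteq V(G)$, $N(X)$ denotes the set of vertices in $V(G)\setminus X$ that have a neighbour in $X$. An $n$-vertex graph $G$ is a $C$-expander if (a) $|N(X)|\ge C|X|$ for every $X\subseteq V(G)$ with $1\le|X|\le\frac{n}{2C}$, and (b) for any two disjoint vertex sets each of size at least $\frac{n}{2C}$ there is an edge of $G$ between them. -}

module Defs where

open import Level using (0ℓ)
open import Data.Fin.Base using (Fin)
open import Data.Fin.Properties using (any?)
open import Data.Fin.Subset using (Subset; _∈_; _∉_; _∩_; ∣_∣; Empty)
open import Data.Fin.Subset.Properties using (_∈?_)
open import Data.Integer.Base using (+_)
open import Data.Nat.Base as ℕ using (ℕ; zero; suc)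
open import Data.Product.Base using (∃; ∃₂; _×_; _,_)
open import Data.Rational.Base as ℚ using (ℚ; 0ℚ; 1ℚ; 1/_)
open import Data.Rational.Literals using (fromℤ)
import Data.Rational.Properties as ℚ
open import Data.Sum.Base using (_⊎_; inj₁; inj₂) renaming (map to ⊎-map)
open import Data.Vec.Base using (tabulate)
open import Relation.Binary.Core using (Rel)
open import Relation.Binary.Definitions using (Symmetric; Irreflexive; Decidable)
open import Relation.Binary.PropositionalEquality
  using (_≡_; refl; sym; trans; cong; subst)
open import Relation.Nullary.Decidable using (Dec; does; yes; no; ¬?; _×-dec_)
open import Relation.Nullary.Negation using (¬_)
open import Relation.Unary using (Pred)

-- Real numbers, as two-sided located Dedekind cuts: L x q means q < x and
-- U x q means x < q.
record ℝ : Set₁ where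
  field
    L U       : Pred ℚ 0ℓ
    L-inhab   : ∃ L
    U-inhab   : ∃ U
    L-down    : ∀ {p q} → p ℚ.< q → L q → L p
    U-up      : ∀ {p q} → p ℚ.< q → U p → U q
    L-open    : ∀ {p} → L p → ∃ λ q → p ℚ.< q × L q
    U-open    : ∀ {q} → U q → ∃ λ p → p ℚ.< q × U p
    disjoint  : ∀ {q} → L q → ¬ U q
    located   : ∀ {p q} → p ℚ.< q → L p ⊎ U q

infix 4 _<ᵣ_ _≤ᵣ_

_<ᵣ_ : Rel ℝ 0ℓ
x <ᵣ y = ∃ λ q → ℝ.U x q × ℝ.L y q

_≤ᵣ_ : Rel ℝ 0ℓ
x ≤ᵣ y = ¬ (y <ᵣ x)

private
  p-1<p : ∀ p → p ℚ.- 1ℚ ℚ.< p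
  p-1<p p = subst (p ℚ.- 1ℚ ℚ.<_) (ℚ.+-identityʳ p)
    (ℚ.+-monoʳ-< p {ℚ.- 1ℚ} {0ℚ} (ℚ.negative⁻¹ (ℚ.- 1ℚ)))

  p<p+1 : ∀ p → p ℚ.< p ℚ.+ 1ℚ
  p<p+1 p = subst (ℚ._< p ℚ.+ 1ℚ) (ℚ.+-identityʳ p)
    (ℚ.+-monoʳ-< p {0ℚ} {1ℚ} (ℚ.positive⁻¹ 1ℚ))

fromℚ : ℚ → ℝ
fromℚ r = record
  { L        = ℚ._< r
  ; U        = r ℚ.<_
  ; L-inhab  = r ℚ.- 1ℚ , p-1<p r
  ; U-inhab  = r ℚ.+ 1ℚ , p<p+1 r
  ; L-down   = ℚ.<-trans
  ; U-up     = λ p<q r<p → ℚ.<-trans r<p p<q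
  ; L-open   = λ p<r → let (m , p<m , m<r) = ℚ.<-dense p<r in m , p<m , m<r
  ; U-open   = λ r<q → let (m , r<m , m<q) = ℚ.<-dense r<q in m , m<q , r<m
  ; disjoint = ℚ.<-asym
  ; located  = loc
  }
  where
  loc : ∀ {p q} → p ℚ.< q → p ℚ.< r ⊎ r ℚ.< q
  loc {p} {q} p<q with p ℚ.<? r
  ... | yes p<r = inj₁ p<r
  ... | no  p≮r = inj₂ (ℚ.≤-<-trans (ℚ.≮⇒≥ p≮r) p<q)

ℕ→ℚ : ℕ → ℚ
ℕ→ℚ k = fromℤ (+ k)

fromℕ : ℕ → ℝ
fromℕ k = fromℚ (ℕ→ℚ k)

-- k · x is the product of the natural number k and the real x.  The strict
-- inequalities against k p, instead of division by k, also cover k = 0.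
infixl 7 _·_

_·_ : ℕ → ℝ → ℝ
k · x = record
  { L        = L′
  ; U        = U′
  ; L-inhab  = let (p , Lp) = L-inhab in ℕ→ℚ k ℚ.* p ℚ.- 1ℚ , p , Lp , p-1<p _
  ; U-inhab  = let (p , Up) = U-inhab in ℕ→ℚ k ℚ.* p ℚ.+ 1ℚ , p , Up , p<p+1 _
  ; L-down   = λ q<r (p , Lp , r<kp) → p , Lp , ℚ.<-trans q<r r<kp
  ; U-up     = λ q<r (p , Up , kp<q) → p , Up , ℚ.<-trans kp<q q<r
  ; L-open   = λ (p , Lp , q<kp) →
      let (m , q<m , m<kp) = ℚ.<-dense q<kp in m , q<m , p , Lp , m<kp
  ; U-open   = λ (p , Up , kp<q) →
      let (m , kp<m , m<q) = ℚ.<-dense kp<q in m , m<q , p , Up , kp<m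
  ; disjoint = disj
  ; located  = loc k
  }
  where
  open ℝ x
  L′ U′ : Pred ℚ 0ℓ
  L′ q = ∃ λ p → L p × q ℚ.< ℕ→ℚ k ℚ.* p
  U′ q = ∃ λ p → U p × ℕ→ℚ k ℚ.* p ℚ.< q

  L≤U : ∀ {p q} → L p → U q → p ℚ.≤ q
  L≤U Lp Uq = ℚ.≮⇒≥ λ q<p → disjoint (L-down q<p Lp) Uq

  disj : ∀ {q} → L′ q → ¬ U′ q
  disj (p , Lp , q<kp) (p′ , Up′ , kp′<q) = ℚ.<-irrefl refl
    (ℚ.<-≤-trans (ℚ.<-trans kp′<q q<kp)
      (ℚ.*-monoˡ-≤-nonNeg (ℕ→ℚ k) (L≤U Lp Up′)))

  loc : ∀ k {q r} → q ℚ.< r →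
        (∃ λ p → L p × q ℚ.< ℕ→ℚ k ℚ.* p) ⊎ (∃ λ p → U p × ℕ→ℚ k ℚ.* p ℚ.< r)
  loc zero {q} {r} q<r with q ℚ.<? 0ℚ
  ... | yes q<0 = let (p , Lp) = L-inhab in
        inj₁ (p , Lp , subst (q ℚ.<_) (sym (ℚ.*-zeroˡ p)) q<0)
  ... | no  q≮0 = let (p , Up) = U-inhab in
        inj₂ (p , Up , subst (ℚ._< r) (sym (ℚ.*-zeroˡ p)) (ℚ.≤-<-trans (ℚ.≮⇒≥ q≮0) q<r))
  loc (suc k) {q} {r} q<r with ℚ.<-dense q<r
  ... | m , q<m , m<r with ℚ.<-dense m<r
  ...   | m′ , m<m′ , m′<r = ⊎-map
          (λ Lp → m ℚ.* 1/k , Lp , subst (q ℚ.<_) (sym (cancel m)) q<m)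
          (λ Up → m′ ℚ.* 1/k , Up , subst (ℚ._< r) (sym (cancel m′)) m′<r)
          (located (ℚ.*-monoˡ-<-pos 1/k m<m′))
    where
    K = ℕ→ℚ (suc k)
    1/k : ℚ
    1/k = 1/ K
    cancel : ∀ t → K ℚ.* (t ℚ.* 1/k) ≡ t
    cancel t = trans (cong (K ℚ.*_) (ℚ.*-comm t 1/k))
      (trans (sym (ℚ.*-assoc K 1/k t))
        (trans (cong (ℚ._* t) (ℚ.*-inverseʳ K)) (ℚ.*-identityˡ t)))

record Graph (n : ℕ) : Set₁ where
  field
    Adj        : Rel (Fin n) 0ℓ
    adj-sym    : Symmetric Adj
    adj-irrefl : Irreflexive _≡_ Adj
    adj?       : Decidable Adj

module _ {n : ℕ} (G : Graph n) where
  open Graph G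

  IsNeighbour : Subset n → Pred (Fin n) 0ℓ
  IsNeighbour X v = v ∉ X × ∃ λ u → u ∈ X × Adj u v

  isNeighbour? : ∀ X v → Dec (IsNeighbour X v)
  isNeighbour? X v = ¬? (v ∈? X) ×-dec any? λ u → (u ∈? X) ×-dec adj? u v

  N : Subset n → Subset n
  N X = tabulate λ v → does (isNeighbour? X v)

  -- Comparisons of ∣ X ∣ with n / 2C are written with the (positive)
  -- denominator 2C cleared.
  record IsExpander (C : ℝ) : Set where
    field
      expands : ∀ X → 1 ℕ.≤ ∣ X ∣ → (2 ℕ.* ∣ X ∣) · C ≤ᵣ fromℕ n →
                ∣ X ∣ · C ≤ᵣ fromℕ ∣ N X ∣
      joined  : ∀ X Y → Empty (X ∩ Y) →
                fromℕ n ≤ᵣ (2 ℕ.* ∣ X ∣) · C → fromℕ n ≤ᵣ (2 ℕ.* ∣ Y ∣) · C →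
                ∃₂ λ u v → u ∈ X × v ∈ Y × Adj u v

  -- A set of edges is represented by its symmetric incidence relation.
  record PerfectMatching : Set₁ where
    field
      M        : Rel (Fin n) 0ℓ
      M-sym    : Symmetric M
      M⊆Adj    : ∀ {u v} → M u v → Adj u v
      matching : ∀ {u v w} → M u v → M u w → v ≡ w
      perfect  : ∀ u → ∃ λ v → M u v

{-# OPTIONS --safe #-}

-- Suppose a matching leaves two vertices u and v uncovered. Grow disjoint
-- alternating trees from u and from v, each with j + 1 outer vertices
-- (reachable by an even alternating path) and j inner ones. While the set X of
-- outer vertices of one tree has size at most n/2C, it has at least 3|X|
-- neighbours, more than there are inner vertices in the two trees together, so
-- some neighbour w is not inner. If w is uncovered or outer in the other tree
-- there is an augmenting path; otherwise w and its partner extend the tree.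
-- Once both outer sets have size at least n/2C, the edge between them gives an
-- augmenting path. No blossoms have to be contracted.

module Submission where

open import Defs
open import Level using (0ℓ; Level)
open import Data.Empty using (⊥; ⊥-elim)
open import Data.Fin.Base using (Fin; zero; suc)
open import Data.Fin.Properties using (_≟_; any?; all?)
open import Data.Fin.Subset using (Subset; inside; outside; _∈_; _∉_; _⊆_; _∪_; ⁅_⁆; ∣_∣)
  renaming (⊤ to ⊤ₛ; ⊥ to ⊥ₛ)
open import Data.Fin.Subset.Properties
import Data.Integer.Base as ℤ
import Data.Integer.Properties as ℤ
open import Data.Nat.Base as ℕ using (ℕ; zero; suc; _+_; _*_; _≤_; _<_; z≤n; s≤s)
open import Data.Nat.Divisibility using (_∣_; ∣m+n∣m⇒∣n; ∣-refl; _∣?_)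
import Data.Nat.Properties as ℕ
open import Data.Product.Base using (∃; _×_; _,_; proj₁; proj₂)
import Data.Rational.Base as ℚ
import Data.Rational.Properties as ℚ
open import Data.Sum.Base using (_⊎_; inj₁; inj₂; [_,_]′) renaming (map to ⊎-map)
open import Data.Vec.Base using (Vec; []; _∷_; here; there; tabulate; lookup)
open import Data.Vec.Properties using (lookup∘tabulate; lookup⇒[]=; []=⇒lookup)
open import Function.Base using (_∘_; id)
open import Relation.Binary.PropositionalEquality
open import Relation.Nullary.Decidable
  using (Dec; yes; no; does; ¬?; _×-dec_; map′; dec-true; from-no)
open import Relation.Nullary.Negation using (¬_; contradiction)
open import Relation.Unary using (Pred; Decidable)

private
  variable
    ℓ : Level
    n m k : ℕ

-- Reals

<ᵣ-asym : ∀ {x y} → x <ᵣ y → ¬ (y <ᵣ x)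
<ᵣ-asym {x} {y} (q , Uxq , Lyq) (r , Uyr , Lxr) = ℝ.disjoint x Lxr
  (subst (ℝ.U x) (ℚ.≤-antisym (≤-of y Lyq Uyr) (≤-of x Lxr Uxq)) Uxq)
  where
  ≤-of : ∀ z {p s} → ℝ.L z p → ℝ.U z s → p ℚ.≤ s
  ≤-of z Lp Us = ℚ.≮⇒≥ λ s<p → ℝ.disjoint z (ℝ.L-down z s<p Lp) Us

-- The order on `ℝ` is not decidable; this lets a contradiction be derived by refuting `x ≤ᵣ y` and
-- `y ≤ᵣ x` separately.
≰ᵣ⇒≥ᵣ : ∀ {x y} → ¬ (x ≤ᵣ y) → y ≤ᵣ x
≰ᵣ⇒≥ᵣ {x} {y} x≰y x<y = x≰y (<ᵣ-asym {x} {y} x<y)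

ℕ→ℚ-mono-< : m < n → ℕ→ℚ m ℚ.< ℕ→ℚ n
ℕ→ℚ-mono-< m<n = ℚ.*<* (ℤ.*-monoʳ-<-pos (ℤ.+ 1) (ℤ.+<+ m<n))

ℕ→ℚ-homo-* : ∀ m n → ℕ→ℚ (m * n) ≡ ℕ→ℚ m ℚ.* ℕ→ℚ n
ℕ→ℚ-homo-* m n =
  trans (sym (ℚ.↥p/↧p≡p (ℕ→ℚ (m * n)))) (cong (ℚ._/ 1) (ℤ.pos-* m n))

-- Turns expansion by the real `C` into a count in `ℕ`. If `m < k * c`, locate `k · C` against a
-- rational `q` between `m` and `k * c`: below `k · C` it refutes the second hypothesis, and
-- otherwise some rational above `C` is less than `c`.
≤ᵣ-·⇒*-≤ : ∀ {C} {c : ℕ} → fromℕ c ≤ᵣ C → k · C ≤ᵣ fromℕ m → k * c ≤ m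
≤ᵣ-·⇒*-≤ {k} {m} {C} {c} c≤C kC≤m = ℕ.≮⇒≥ λ m<kc →
  let (q , m<q , q<kc) = ℚ.<-dense (ℕ→ℚ-mono-< m<kc) in
  [ (λ q<kC → kC≤m (q , m<q , q<kC))
  , (λ (p , Up , kp<kc) → c≤C (p , Up ,
      ℚ.*-cancelˡ-<-nonNeg (ℕ→ℚ k) (subst (_ ℚ.<_) (ℕ→ℚ-homo-* k c) kp<kc)))
  ]′ (ℝ.located (k · C) q<kc)

-- Finite sets

∈-tabulate⁺ : {P : Pred (Fin n) ℓ} (P? : Decidable P) →
              ∀ {x} → P x → x ∈ tabulate (does ∘ P?)
∈-tabulate⁺ P? {x} Px =
  lookup⇒[]= x _ (trans (lookup∘tabulate _ x) (dec-true (P? x) Px))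

∈-tabulate⁻ : {P : Pred (Fin n) ℓ} (P? : Decidable P) →
              ∀ {x} → x ∈ tabulate (does ∘ P?) → P x
∈-tabulate⁻ P? {x} x∈ with P? x | trans (sym (lookup∘tabulate (does ∘ P?) x)) ([]=⇒lookup x∈)
... | yes Px | _  = Px
... | no _   | ()

∣p∪q∣≤∣p∣+∣q∣ : (p q : Subset n) → ∣ p ∪ q ∣ ≤ ∣ p ∣ + ∣ q ∣
∣p∪q∣≤∣p∣+∣q∣ [] [] = z≤n
∣p∪q∣≤∣p∣+∣q∣ (outside ∷ p) (outside ∷ q) = ∣p∪q∣≤∣p∣+∣q∣ p q
∣p∪q∣≤∣p∣+∣q∣ (outside ∷ p) (inside ∷ q) =
  ℕ.≤-trans (s≤s (∣p∪q∣≤∣p∣+∣q∣ p q)) (ℕ.≤-reflexive (sym (ℕ.+-suc ∣ p ∣ ∣ q ∣)))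
∣p∪q∣≤∣p∣+∣q∣ (inside ∷ p) (outside ∷ q) = s≤s (∣p∪q∣≤∣p∣+∣q∣ p q)
∣p∪q∣≤∣p∣+∣q∣ (inside ∷ p) (inside ∷ q) = s≤s (ℕ.≤-trans (∣p∪q∣≤∣p∣+∣q∣ p q)
  (ℕ.+-monoʳ-≤ ∣ p ∣ (ℕ.n≤1+n ∣ q ∣)))

x∉p⇒∣p∪⁅x⁆∣≡1+∣p∣ : ∀ (p : Subset n) {x} → x ∉ p → ∣ p ∪ ⁅ x ⁆ ∣ ≡ suc ∣ p ∣
x∉p⇒∣p∪⁅x⁆∣≡1+∣p∣ (outside ∷ p) {zero} x∉p = cong (suc ∘ ∣_∣) (∪-identityʳ p)
x∉p⇒∣p∪⁅x⁆∣≡1+∣p∣ (inside ∷ p) {zero} x∉p = contradiction here x∉p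
x∉p⇒∣p∪⁅x⁆∣≡1+∣p∣ (outside ∷ p) {suc x} x∉p = x∉p⇒∣p∪⁅x⁆∣≡1+∣p∣ p (x∉p ∘ there)
x∉p⇒∣p∪⁅x⁆∣≡1+∣p∣ (inside ∷ p) {suc x} x∉p = cong suc (x∉p⇒∣p∪⁅x⁆∣≡1+∣p∣ p (x∉p ∘ there))

x∈p∪⁅y⁆⁻ : ∀ (p : Subset n) {x y} → x ∈ p ∪ ⁅ y ⁆ → x ∈ p ⊎ x ≡ y
x∈p∪⁅y⁆⁻ p {y = y} x∈ = ⊎-map id (x∈⁅y⁆⇒x≡y y) (x∈p∪q⁻ p ⁅ y ⁆ x∈)

p⊆p∪⁅y⁆ : ∀ (p : Subset n) y → p ⊆ p ∪ ⁅ y ⁆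
p⊆p∪⁅y⁆ p y = p⊆p∪q ⁅ y ⁆

y∈p∪⁅y⁆ : ∀ (p : Subset n) y → y ∈ p ∪ ⁅ y ⁆
y∈p∪⁅y⁆ p y = q⊆p∪q p ⁅ y ⁆ (x∈⁅x⁆ y)

-- Vectors stand in for functions: a search over functions would need `P` to respect pointwise
-- equality.
anyVec? : ∀ k {P : Pred (Vec (Fin m) k) ℓ} → Decidable P → Dec (∃ P)
anyVec? zero P? = map′ (λ P[] → [] , P[]) (λ { ([] , P[]) → P[] }) (P? [])
anyVec? (suc k) P? = map′ (λ (x , xs , Pxs) → x ∷ xs , Pxs) (λ { (x ∷ xs , Pxs) → x , xs , Pxs })
  (any? λ x → anyVec? k λ xs → P? (x ∷ xs))

-- Involutions

Involutive : (Fin n → Fin n) → Set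
Involutive f = ∀ x → f (f x) ≡ x

fixed : (Fin n → Fin n) → Subset n
fixed f = tabulate λ x → does (f x ≟ x)

∈-fixed⁺ : ∀ (f : Fin n → Fin n) {x} → f x ≡ x → x ∈ fixed f
∈-fixed⁺ f = ∈-tabulate⁺ (λ x → f x ≟ x)

∈-fixed⁻ : ∀ (f : Fin n → Fin n) {x} → x ∈ fixed f → f x ≡ x
∈-fixed⁻ f = ∈-tabulate⁻ (λ x → f x ≟ x)

∣fixed∣-< : ∀ {f h : Fin n → Fin n} {w} → f w ≡ w →
            (∀ z → h z ≡ z → f z ≡ z × z ≢ w) → ∣ fixed h ∣ < ∣ fixed f ∣
∣fixed∣-< {f = f} {h} {w} fw shrinks = p⊂q⇒∣p∣<∣q∣
  ( (λ {z} z∈ → ∈-fixed⁺ f (proj₁ (shrinks z (∈-fixed⁻ h z∈))))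
  , w , ∈-fixed⁺ f fw , λ w∈ → proj₂ (shrinks w (∈-fixed⁻ h w∈)) refl)

module _ (f : Fin n → Fin n) (x y : Fin n) where

  -- Adds the edge `x y` to a matching. It is applied only where `f` fixes both ends, so no former
  -- partner still points to them.
  link : Fin n → Fin n
  link z with z ≟ x | z ≟ y
  ... | yes _ | _     = y
  ... | no _  | yes _ = x
  ... | no _  | no _  = f z

  link-x : link x ≡ y
  link-x with x ≟ x
  ... | yes _  = refl
  ... | no x≢x = contradiction refl x≢x

  link-y : link y ≡ x
  link-y with y ≟ x | y ≟ y
  ... | yes y≡x | _      = y≡x
  ... | no _    | yes _  = refl
  ... | no _    | no y≢y = contradiction refl y≢y

  link-other : ∀ {z} → z ≢ x → z ≢ y → link z ≡ f z
  link-other {z} z≢x z≢y with z ≟ x | z ≟ y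
  ... | yes z≡x | _       = contradiction z≡x z≢x
  ... | no _    | yes z≡y = contradiction z≡y z≢y
  ... | no _    | no _    = refl

  link-fixed⁻ : x ≢ y → ∀ {z} → link z ≡ z → f z ≡ z × z ≢ x × z ≢ y
  link-fixed⁻ x≢y {z} fix with z ≟ x | z ≟ y
  ... | yes z≡x | _       = contradiction (trans (sym z≡x) (sym fix)) x≢y
  ... | no _    | yes z≡y = contradiction (trans fix z≡y) x≢y
  ... | no z≢x  | no z≢y  = fix , z≢x , z≢y

  link-involutive : Involutive f → f x ≡ x → f y ≡ y → Involutive link
  link-involutive inv fx fy z = go (z ≟ x) (z ≟ y)
    where
    avoid : ∀ {a} → f a ≡ a → z ≢ a → f z ≢ a
    avoid fa z≢a fz≡a = z≢a (trans (sym (inv z)) (trans (cong f fz≡a) fa))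
    go : Dec (z ≡ x) → Dec (z ≡ y) → link (link z) ≡ z
    go (yes refl) _ = trans (cong link link-x) link-y
    go (no _) (yes refl) = trans (cong link link-y) link-x
    go (no z≢x) (no z≢y) = trans (cong link (link-other z≢x z≢y))
      (trans (link-other (avoid fx z≢x) (avoid fy z≢y)) (inv z))

module _ (f : Fin n → Fin n) (w : Fin n) where

  unlink : Fin n → Fin n
  unlink z with z ≟ w | z ≟ f w
  ... | yes _ | _     = z
  ... | no _  | yes _ = z
  ... | no _  | no _  = f z

  unlink-w : unlink w ≡ w
  unlink-w with w ≟ w
  ... | yes _  = refl
  ... | no w≢w = contradiction refl w≢w

  unlink-fw : unlink (f w) ≡ f w
  unlink-fw with f w ≟ w | f w ≟ f w
  ... | yes _ | _        = refl
  ... | no _  | yes _    = refl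
  ... | no _  | no fw≢fw = contradiction refl fw≢fw

  unlink-other : ∀ {z} → z ≢ w → z ≢ f w → unlink z ≡ f z
  unlink-other {z} z≢w z≢fw with z ≟ w | z ≟ f w
  ... | yes z≡w | _        = contradiction z≡w z≢w
  ... | no _    | yes z≡fw = contradiction z≡fw z≢fw
  ... | no _    | no _     = refl

  unlink-fixed⁺ : ∀ {z} → f z ≡ z → unlink z ≡ z
  unlink-fixed⁺ {z} fz with z ≟ w | z ≟ f w
  ... | yes _ | _     = refl
  ... | no _  | yes _ = refl
  ... | no _  | no _  = fz

  unlink-fixed⁻ : ∀ {z} → unlink z ≡ z → f z ≡ z ⊎ z ≡ w ⊎ z ≡ f w
  unlink-fixed⁻ {z} fix with z ≟ w | z ≟ f w
  ... | yes z≡w | _        = inj₂ (inj₁ z≡w)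
  ... | no _    | yes z≡fw = inj₂ (inj₂ z≡fw)
  ... | no _    | no _     = inj₁ fix

  unlink-involutive : Involutive f → Involutive unlink
  unlink-involutive inv z = go (z ≟ w) (z ≟ f w)
    where
    go : Dec (z ≡ w) → Dec (z ≡ f w) → unlink (unlink z) ≡ z
    go (yes refl) _ = trans (cong unlink unlink-w) unlink-w
    go (no _) (yes refl) = trans (cong unlink unlink-fw) unlink-fw
    go (no z≢w) (no z≢fw) = trans (cong unlink (unlink-other z≢w z≢fw))
      (trans (unlink-other (λ fz≡w → z≢fw (trans (sym (inv z)) (cong f fz≡w)))
                           (λ fz≡fw → z≢w (trans (sym (inv z)) (trans (cong f fz≡fw) (inv w)))))
             (inv z))

  ∣fixed-unlink∣ : Involutive f → f w ≢ w → ∣ fixed unlink ∣ ≡ 2 + ∣ fixed f ∣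
  ∣fixed-unlink∣ inv fw≢w = trans (cong ∣_∣ (⊆-antisym ⇒ ⇐))
    (trans (x∉p⇒∣p∪⁅x⁆∣≡1+∣p∣ F∪w fw∉) (cong suc (x∉p⇒∣p∪⁅x⁆∣≡1+∣p∣ F (fw≢w ∘ ∈-fixed⁻ f))))
    where
    F F∪w : Subset n
    F   = fixed f
    F∪w = F ∪ ⁅ w ⁆
    fw∉ : f w ∉ F∪w
    fw∉ fw∈ = [ (λ fw∈F → fw≢w (trans (sym (∈-fixed⁻ f fw∈F)) (inv w))) , fw≢w ]′
      (x∈p∪⁅y⁆⁻ F fw∈)
    ⇒ : fixed unlink ⊆ F∪w ∪ ⁅ f w ⁆
    ⇒ z∈ with unlink-fixed⁻ (∈-fixed⁻ unlink z∈)
    ... | inj₁ fz          = p⊆p∪⁅y⁆ F∪w (f w) (p⊆p∪⁅y⁆ F w (∈-fixed⁺ f fz))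
    ... | inj₂ (inj₁ refl) = p⊆p∪⁅y⁆ F∪w (f w) (y∈p∪⁅y⁆ F w)
    ... | inj₂ (inj₂ refl) = y∈p∪⁅y⁆ F∪w (f w)
    ⇐ : F∪w ∪ ⁅ f w ⁆ ⊆ fixed unlink
    ⇐ z∈ with x∈p∪⁅y⁆⁻ F∪w z∈
    ... | inj₂ refl = ∈-fixed⁺ unlink unlink-fw
    ... | inj₁ z∈′ with x∈p∪⁅y⁆⁻ F z∈′
    ...   | inj₁ z∈F  = ∈-fixed⁺ unlink (unlink-fixed⁺ (∈-fixed⁻ f z∈F))
    ...   | inj₂ refl = ∈-fixed⁺ unlink unlink-w

-- Unlinking a pair adds exactly two fixed points, and once no pair is left all `n` points are
-- fixed.
2∣∣fixed∣ : 2 ∣ n → (f : Fin n → Fin n) → Involutive f → 2 ∣ ∣ fixed f ∣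
2∣∣fixed∣ {n} 2∣n f₀ inv₀ = go n f₀ inv₀ (ℕ.m≤m+n n ∣ fixed f₀ ∣)
  where
  -- `k` bounds the number of points moved by `f`. An unlinking removes two of them; charging one is
  -- enough for termination.
  go : ∀ k (f : Fin n → Fin n) → Involutive f → n ≤ k + ∣ fixed f ∣ → 2 ∣ ∣ fixed f ∣
  go zero f inv n≤ = subst (2 ∣_) (ℕ.≤-antisym n≤ (∣p∣≤n (fixed f))) 2∣n
  go (suc k) f inv n≤ with any? (λ w → ¬? (f w ≟ w))
  ... | yes (w , fw≢w) = ∣m+n∣m⇒∣n (subst (2 ∣_) eq
          (go k (unlink f w) (unlink-involutive f w inv) bound)) ∣-refl
    where
    eq : ∣ fixed (unlink f w) ∣ ≡ 2 + ∣ fixed f ∣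
    eq = ∣fixed-unlink∣ f w inv fw≢w
    bound : n ≤ k + ∣ fixed (unlink f w) ∣
    bound = ℕ.≤-trans n≤ (ℕ.≤-trans (ℕ.≤-reflexive (sym (ℕ.+-suc k _)))
      (ℕ.+-monoʳ-≤ k (ℕ.≤-trans (ℕ.n≤1+n _) (ℕ.≤-reflexive (sym eq)))))
  ... | no all-fixed = subst (2 ∣_) (sym (trans (cong ∣_∣ fixed≡⊤) (∣⊤∣≡n n))) 2∣n
    where
    fixed≡⊤ : fixed f ≡ ⊤ₛ
    fixed≡⊤ = ⊆-antisym ⊆⊤ λ {x} _ → ∈-fixed⁺ f (fixes x (f x ≟ x))
      where
      fixes : ∀ x → Dec (f x ≡ x) → f x ≡ x
      fixes x (yes fx) = fx
      fixes x (no fx≢) = contradiction (x , fx≢) all-fixed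

-- Matchings of a graph

module _ {n : ℕ} (G : Graph n) where
  open Graph G

  -- A matching is encoded by the involution that swaps the ends of its edges;
  -- the fixed points are the uncovered vertices.
  record IsMatching (f : Fin n → Fin n) : Set where
    field
      involutive : Involutive f
      adjacent   : ∀ x → f x ≢ x → Adj x (f x)
  open IsMatching

  Adj⇒≢ : ∀ {x y} → Adj x y → x ≢ y
  Adj⇒≢ xy x≡y = adj-irrefl x≡y xy

  link-isMatching : ∀ {f x y} → IsMatching f → f x ≡ x → f y ≡ y → Adj x y →
                    IsMatching (link f x y)
  link-isMatching {f} {x} {y} mf fx fy xy = record
    { involutive = link-involutive f x y (involutive mf) fx fy
    ; adjacent   = λ z → adj z (z ≟ x) (z ≟ y)
    }
    where
    adj : ∀ z → Dec (z ≡ x) → Dec (z ≡ y) → link f x y z ≢ z → Adj z (link f x y z)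
    adj z (yes refl) _ _ = subst (Adj z) (sym (link-x f x y)) xy
    adj z (no _) (yes refl) _ = subst (Adj z) (sym (link-y f x y)) (adj-sym xy)
    adj z (no z≢x) (no z≢y) ≢z = subst (Adj z) (sym eq) (adjacent mf z (≢z ∘ trans eq))
      where
      eq : link f x y z ≡ f z
      eq = link-other f x y z≢x z≢y

  unlink-isMatching : ∀ {f} w → IsMatching f → IsMatching (unlink f w)
  unlink-isMatching {f} w mf = record
    { involutive = unlink-involutive f w (involutive mf)
    ; adjacent   = λ z → adj z (z ≟ w) (z ≟ f w)
    }
    where
    adj : ∀ z → Dec (z ≡ w) → Dec (z ≡ f w) → unlink f w z ≢ z → Adj z (unlink f w z)
    adj z (yes refl) _ ≢z = contradiction (unlink-w f w) ≢z
    adj z (no _) (yes refl) ≢z = contradiction (unlink-fw f w) ≢z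
    adj z (no z≢w) (no z≢fw) ≢z = subst (Adj z) (sym eq) (adjacent mf z (≢z ∘ trans eq))
      where
      eq : unlink f w z ≡ f z
      eq = unlink-other f w z≢w z≢fw

  -- A table of partners, in a form that finite search can decide. Irreflexivity of `Adj` already
  -- rules out fixed points.
  IsPerfect : Vec (Fin n) n → Set
  IsPerfect v = ∀ x → lookup v (lookup v x) ≡ x × Adj x (lookup v x)

  isPerfect? : Decidable IsPerfect
  isPerfect? v = all? λ x → (lookup v (lookup v x) ≟ x) ×-dec adj? x (lookup v x)

  IsPerfect⇒PerfectMatching : ∃ IsPerfect → PerfectMatching G
  IsPerfect⇒PerfectMatching (v , perf) = record
    { M        = λ x y → lookup v x ≡ y
    ; M-sym    = λ { {x} refl → proj₁ (perf x) }
    ; M⊆Adj    = λ { {x} refl → proj₂ (perf x) }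
    ; matching = λ xy xz → trans (sym xy) xz
    ; perfect  = λ x → lookup v x , refl
    }

  covering⇒IsPerfect : ∀ {f} → IsMatching f → (∀ x → f x ≢ x) → ∃ IsPerfect
  covering⇒IsPerfect {f} mf f≢ = tabulate f , λ x →
    trans (eq (lookup (tabulate f) x)) (trans (cong f (eq x)) (involutive mf x)) ,
    subst (Adj x) (sym (eq x)) (adjacent mf x (f≢ x))
    where
    eq : ∀ x → lookup (tabulate f) x ≡ f x
    eq = lookup∘tabulate f

  -- Alternating trees and augmentation

  module AlternatingTrees (f : Fin n → Fin n) (mf : IsMatching f)
    -- The form that maximality of `f` takes here; the induction on the number of uncovered vertices
    -- supplies it.
    (unaugmentable : ∀ {h u} → IsMatching h → f u ≡ u →
                     (∀ z → h z ≡ z → f z ≡ z × z ≢ u) → ⊥) where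

    -- An alternating path inside T from u to x can be switched in every
    -- matching g that agrees with f on T; letting g vary makes it possible to
    -- switch paths in disjoint trees one after the other.
    Reach : Pred (Fin n) 0ℓ → Fin n → Fin n → Set
    Reach T u x = ∀ g → IsMatching g → (∀ z → T z → g z ≡ f z) →
      ∃ λ h → IsMatching h × (∀ z → ¬ T z → h z ≡ g z) × h x ≡ x ×
              (∀ z → h z ≡ z → z ≡ x ⊎ (g z ≡ z × z ≢ u))

    reach-root : ∀ {T : Pred (Fin n) 0ℓ} {u} → f u ≡ u → T u → Reach T u u
    reach-root {u = u} fu Tu g mg g≗f =
      g , mg , (λ _ _ → refl) , trans (g≗f u Tu) fu , λ z gz → split z gz (z ≟ u)
      where
      split : ∀ z → g z ≡ z → Dec (z ≡ u) → z ≡ u ⊎ (g z ≡ z × z ≢ u)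
      split z gz (yes z≡u) = inj₁ z≡u
      split z gz (no z≢u)  = inj₂ (gz , z≢u)

    -- Switching the path to `x` uncovers `x` and leaves `w` matched to `f w`, since `w` is outside
    -- `T`. Replacing the edge from `w` to `f w` by `x w` then moves the uncovered vertex to `f w`.
    reach-extend : ∀ {T T′ : Pred (Fin n) 0ℓ} {u x w} → (∀ {z} → T z → T′ z) →
                   T x → ¬ T w → T′ w → T′ (f w) → f w ≢ w → Adj x w →
                   Reach T u x → Reach T′ u (f w)
    reach-extend {T} {T′} {u} {x} {w} T⊆T′ Tx ¬Tw T′w T′fw fw≢w xw reach g mg g≗f
      with reach g mg (λ z Tz → g≗f z (T⊆T′ Tz))
    ... | h , mh , h≗g , hx , h-fixed =
      h₂ , link-isMatching mh₁ h₁x (unlink-w h w) xw , h₂≗g ,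
      trans (link-other h₁ x w fw≢x fw≢w) h₁fw , h₂-fixed
      where
      h₁ h₂ : Fin n → Fin n
      h₁ = unlink h w
      h₂ = link h₁ x w
      mh₁ : IsMatching h₁
      mh₁ = unlink-isMatching w mh
      hw : h w ≡ f w
      hw = trans (h≗g w ¬Tw) (g≗f w T′w)
      h₁fw : h₁ (f w) ≡ f w
      h₁fw = subst (λ y → h₁ y ≡ y) hw (unlink-fw h w)
      h₁x : h₁ x ≡ x
      h₁x = unlink-fixed⁺ h w hx
      fw≢x : f w ≢ x
      -- Otherwise `h` would swap `x` and `w` while fixing `x`, forcing `x ≡ w`.
      fw≢x fw≡x = Adj⇒≢ xw (trans (sym hx)
        (trans (cong h (sym (trans hw fw≡x))) (involutive mh w)))
      h₂≗g : ∀ z → ¬ T′ z → h₂ z ≡ g z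
      h₂≗g z ¬T′z =
        trans (link-other h₁ x w (λ { refl → ¬T′z (T⊆T′ Tx) }) z≢w)
        (trans (unlink-other h w z≢w λ { z≡hw → ¬T′z (subst T′ (sym (trans z≡hw hw)) T′fw) })
               (h≗g z (¬T′z ∘ T⊆T′)))
        where
        z≢w : z ≢ w
        z≢w refl = ¬T′z T′w
      h₂-fixed : ∀ z → h₂ z ≡ z → z ≡ f w ⊎ (g z ≡ z × z ≢ u)
      h₂-fixed z fix with link-fixed⁻ h₁ x w (Adj⇒≢ xw) fix
      ... | h₁z , z≢x , z≢w with unlink-fixed⁻ h w h₁z
      ...   | inj₂ (inj₁ z≡w)  = contradiction z≡w z≢w
      ...   | inj₂ (inj₂ z≡hw) = inj₁ (trans z≡hw hw)
      ...   | inj₁ hz with h-fixed z hz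
      ...     | inj₁ z≡x = contradiction z≡x z≢x
      ...     | inj₂ p   = inj₂ p

    -- The path from `u` to `x` followed by the edge `x w` is augmenting: after the switch both `x`
    -- and `w` are free to be linked.
    no-uncovered-exit : ∀ {T u x w} → f u ≡ u → Reach T u x → ¬ T w → f w ≡ w → ¬ Adj x w
    no-uncovered-exit {x = x} {w} fu reach ¬Tw fw xw
      with reach f mf (λ _ _ → refl)
    ... | h , mh , h≗f , hx , h-fixed =
      unaugmentable (link-isMatching mh hx (trans (h≗f w ¬Tw) fw) xw) fu λ z fix →
        let (hz , z≢x , _) = link-fixed⁻ h x w (Adj⇒≢ xw) fix in
        [ (λ z≡x → contradiction z≡x z≢x) , id ]′ (h-fixed z hz)

    -- The path to `x` is switched first. As `S` and `T` are disjoint, the result still agrees with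
    -- `f` on `T`, so the path to `y` can be switched next, and this leaves `x` uncovered. Linking
    -- `x` and `y` completes an augmentation.
    no-crossing-edge : ∀ {S T u v x y} → f u ≡ u → (∀ {z} → S z → ¬ T z) → S x →
                       Reach S u x → Reach T v y → ¬ Adj x y
    no-crossing-edge {x = x} {y} fu disj Sx reachˣ reachʸ xy
      with reachˣ f mf (λ _ _ → refl)
    ... | h , mh , h≗f , hx , h-fixed
      with reachʸ h mh (λ z Tz → h≗f z λ Sz → disj Sz Tz)
    ... | h′ , mh′ , h′≗h , h′y , h′-fixed =
      unaugmentable (link-isMatching mh′ (trans (h′≗h x (disj Sx)) hx) h′y xy) fu λ z fix →
        let (h′z , z≢x , z≢y) = link-fixed⁻ h′ x y (Adj⇒≢ xy) fix in
        [ (λ z≡y → contradiction z≡y z≢y)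
        , (λ (hz , _) → [ (λ z≡x → contradiction z≡x z≢x) , id ]′ (h-fixed z hz))
        ]′ (h′-fixed z h′z)

    -- No tree edges are stored: `X` holds the outer vertices, `Y` the inner ones, and `reach` keeps
    -- all that is used of the paths. By `closed`, a vertex outside the tree has its partner outside
    -- too.
    record Tree (u : Fin n) (j : ℕ) : Set where
      field
        X Y : Subset n

      T : Pred (Fin n) 0ℓ
      T z = z ∈ X ⊎ z ∈ Y

      field
        ∣X∣    : ∣ X ∣ ≡ suc j
        ∣Y∣    : ∣ Y ∣ ≡ j
        closed : ∀ {z} → T z → T (f z)
        reach  : ∀ {x} → x ∈ X → Reach T u x
    open Tree

    Disjoint : ∀ {u v i j} → Tree u i → Tree v j → Set
    Disjoint A B = ∀ {z} → T A z → ¬ T B z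

    root : ∀ {u} → f u ≡ u → Tree u 0
    root {u} fu = record
      { X      = ⁅ u ⁆
      ; Y      = ⊥ₛ
      ; ∣X∣    = ∣⁅x⁆∣≡1 u
      ; ∣Y∣    = ∣⊥∣≡0 n
      ; closed = λ { (inj₁ z∈) → inj₁ (closed′ (x∈⁅y⁆⇒x≡y u z∈)) ; (inj₂ z∈) → contradiction z∈ ∉⊥ }
      ; reach  = λ x∈ → reach′ (x∈⁅y⁆⇒x≡y u x∈)
      }
      where
      closed′ : ∀ {z} → z ≡ u → f z ∈ ⁅ u ⁆
      closed′ refl = subst (_∈ ⁅ u ⁆) (sym fu) (x∈⁅x⁆ u)
      reach′ : ∀ {x} → x ≡ u → Reach (λ z → z ∈ ⁅ u ⁆ ⊎ z ∈ ⊥ₛ) u x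
      reach′ refl = reach-root fu (inj₁ (x∈⁅x⁆ u))

    root-disjoint : ∀ {u v} (fu : f u ≡ u) (fv : f v ≡ v) → u ≢ v →
                    Disjoint (root fu) (root fv)
    root-disjoint {u} {v} fu fv u≢v (inj₁ z∈) (inj₁ z∈′) =
      u≢v (trans (sym (x∈⁅y⁆⇒x≡y u z∈)) (x∈⁅y⁆⇒x≡y v z∈′))
    root-disjoint fu fv u≢v (inj₁ _) (inj₂ z∈) = ∉⊥ z∈
    root-disjoint fu fv u≢v (inj₂ z∈) _ = ∉⊥ z∈

    extend : ∀ {u x w j} (A : Tree u j) → x ∈ X A → ¬ T A w → f w ≢ w → Adj x w →
             Tree u (suc j)
    extend {u} {x} {w} {j} A x∈ ¬Tw fw≢w xw = record
      { X      = X′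
      ; Y      = Y′
      ; ∣X∣    = trans (x∉p⇒∣p∪⁅x⁆∣≡1+∣p∣ (X A) (¬Tfw ∘ inj₁)) (cong suc (∣X∣ A))
      ; ∣Y∣    = trans (x∉p⇒∣p∪⁅x⁆∣≡1+∣p∣ (Y A) (¬Tw ∘ inj₂)) (cong suc (∣Y∣ A))
      ; closed = [ (λ z∈ → closedˣ (x∈p∪⁅y⁆⁻ (X A) z∈)) , (λ z∈ → closedʸ (x∈p∪⁅y⁆⁻ (Y A) z∈)) ]′
      ; reach  = λ z∈ → reach′ (x∈p∪⁅y⁆⁻ (X A) z∈)
      }
      where
      X′ Y′ : Subset n
      X′ = X A ∪ ⁅ f w ⁆
      Y′ = Y A ∪ ⁅ w ⁆
      T′ : Pred (Fin n) 0ℓ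
      T′ z = z ∈ X′ ⊎ z ∈ Y′
      ¬Tfw : ¬ T A (f w)
      ¬Tfw Tfw = ¬Tw (subst (T A) (involutive mf w) (closed A Tfw))
      T⊆T′ : ∀ {z} → T A z → T′ z
      T⊆T′ = ⊎-map (p⊆p∪⁅y⁆ (X A) (f w)) (p⊆p∪⁅y⁆ (Y A) w)
      T′fw : T′ (f w)
      T′fw = inj₁ (y∈p∪⁅y⁆ (X A) (f w))
      T′w : T′ w
      T′w = inj₂ (y∈p∪⁅y⁆ (Y A) w)
      closedˣ : ∀ {z} → z ∈ X A ⊎ z ≡ f w → T′ (f z)
      closedˣ (inj₁ z∈)   = T⊆T′ (closed A (inj₁ z∈))
      closedˣ (inj₂ refl) = subst T′ (sym (involutive mf w)) T′w
      closedʸ : ∀ {z} → z ∈ Y A ⊎ z ≡ w → T′ (f z)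
      closedʸ (inj₁ z∈)   = T⊆T′ (closed A (inj₂ z∈))
      closedʸ (inj₂ refl) = T′fw
      reach′ : ∀ {z} → z ∈ X A ⊎ z ≡ f w → Reach T′ u z
      reach′ (inj₂ refl) = reach-extend T⊆T′ (inj₁ x∈) ¬Tw T′w T′fw fw≢w xw (reach A x∈)
      -- An old path remains switchable: agreement on `T′` includes agreement on the smaller set.
      reach′ (inj₁ z∈) g mg g≗f =
        let (h , mh , h≗g , rest) = reach A z∈ g mg (λ y Ty → g≗f y (T⊆T′ Ty)) in
        h , mh , (λ y ¬T′y → h≗g y (¬T′y ∘ T⊆T′)) , rest

    extend-disjoint : ∀ {u v x w i j} (A : Tree u j) (B : Tree v i) (x∈ : x ∈ X A)
                      (¬Tw : ¬ T A w) (fw≢w : f w ≢ w) (xw : Adj x w) →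
                      Disjoint A B → ¬ T B w → Disjoint (extend A x∈ ¬Tw fw≢w xw) B
    extend-disjoint {w = w} A B x∈ ¬Tw fw≢w xw disj ¬TBw =
      [ (λ z∈ → [ disj ∘ inj₁ , (λ { refl TBfw →
          ¬TBw (subst (T B) (involutive mf w) (closed B TBfw)) }) ]′ (x∈p∪⁅y⁆⁻ (X A) z∈))
      , (λ z∈ → [ disj ∘ inj₂ , (λ { refl → ¬TBw }) ]′ (x∈p∪⁅y⁆⁻ (Y A) z∈))
      ]′

    -- The trees grow in turn, so `B` may be one step ahead, whence `i ≤ suc j`. The inner vertices
    -- number at most `2j + 1`, fewer than the neighbours of `X A`, so some neighbour `w` is inner
    -- in neither tree.
    grow : ∀ {u v i j} → f u ≡ u → (A : Tree u j) (B : Tree v i) → i ≤ suc j →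
           Disjoint A B → suc j * 3 ≤ ∣ N G (X A) ∣ → ∃ λ (A′ : Tree u (suc j)) → Disjoint A′ B
    grow {i = i} {j} fu A B i≤ disj 3∣X∣≤
      with any? (λ w → (w ∈? N G (X A)) ×-dec ¬? (w ∈? (Y A ∪ Y B)))
    ... | no none = contradiction 3∣X∣≤ (ℕ.<⇒≱ (ℕ.≤-<-trans ∣N∣≤ j+i<3[1+j]))
      where
      N⊆Y∪Y : N G (X A) ⊆ Y A ∪ Y B
      N⊆Y∪Y {w} w∈N with w ∈? (Y A ∪ Y B)
      ... | yes w∈ = w∈
      ... | no w∉  = contradiction (w , w∈N , w∉) none
      ∣N∣≤ : ∣ N G (X A) ∣ ≤ j + i
      ∣N∣≤ = ℕ.≤-trans (p⊆q⇒∣p∣≤∣q∣ N⊆Y∪Y) (ℕ.≤-trans (∣p∪q∣≤∣p∣+∣q∣ (Y A) (Y B))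
        (ℕ.≤-reflexive (cong₂ _+_ (∣Y∣ A) (∣Y∣ B))))
      j+i<3[1+j] : j + i < suc j * 3
      -- `suc j + (suc j + (suc j + 0))` is `3 * suc j` unfolded.
      j+i<3[1+j] = ℕ.≤-trans (ℕ.+-monoʳ-≤ (suc j) (ℕ.≤-trans i≤ (ℕ.m≤m+n (suc j) (suc j + 0))))
        (ℕ.≤-reflexive (ℕ.*-comm 3 (suc j)))
    ... | yes (w , w∈N , w∉Y∪Y) with ∈-tabulate⁻ (isNeighbour? G (X A)) w∈N
    ...   | w∉X , x , x∈ , xw = go (f w ≟ w)
      where
      ¬TAw : ¬ T A w
      ¬TAw = [ w∉X , w∉Y∪Y ∘ p⊆p∪q (Y B) ]′
      ¬TBw : ¬ T B w
      ¬TBw = [ (λ w∈ → no-crossing-edge fu disj (inj₁ x∈)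
                         (reach A x∈) (reach B w∈) xw)
             , w∉Y∪Y ∘ q⊆p∪q (Y A) (Y B) ]′
      go : Dec (f w ≡ w) → ∃ λ (A′ : Tree _ (suc j)) → Disjoint A′ B
      go (yes fw)  = ⊥-elim (no-uncovered-exit fu (reach A x∈) ¬TAw fw xw)
      go (no fw≢w) = extend A x∈ ¬TAw fw≢w xw , extend-disjoint A B x∈ ¬TAw fw≢w xw disj ¬TBw

    -- Two disjoint trees in an expander

    module _ {C : ℝ} (3≤C : fromℕ 3 ≤ᵣ C) (expander : IsExpander G C) where
      open IsExpander expander

      -- Each round enlarges both trees, and `fuel` runs out only when `n ≤ j`, which the `suc j`
      -- outer vertices contradict. The outer sets have equal size, so one comparison with `n`
      -- serves both trees.
      no-disjoint-trees : ∀ {u v} → f u ≡ u → f v ≡ v → ∀ fuel {j} → n ≤ j + fuel →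
        (A : Tree u j) (B : Tree v j) → ¬ Disjoint A B
      no-disjoint-trees fu fv zero {j} n≤ A B disj =
        ℕ.<-irrefl refl (ℕ.≤-trans (subst (_≤ n) (∣X∣ A) (∣p∣≤n (X A)))
          (subst (n ≤_) (ℕ.+-identityʳ j) n≤))
      no-disjoint-trees {u} {v} fu fv (suc fuel) {j} n≤ A B disj =
        large (≰ᵣ⇒≥ᵣ {(2 * suc j) · C} {fromℕ n} small)
        where
        expands′ : ∀ {u} → (D : Tree u j) → (2 * suc j) · C ≤ᵣ fromℕ n →
                   suc j * 3 ≤ ∣ N G (X D) ∣
        expands′ D le = ≤ᵣ-·⇒*-≤ {C = C} 3≤C (subst (λ k → k · C ≤ᵣ fromℕ ∣ N G (X D) ∣) (∣X∣ D)
          (expands (X D) (subst (1 ≤_) (sym (∣X∣ D)) (s≤s z≤n))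
            (subst (λ k → (2 * k) · C ≤ᵣ fromℕ n) (sym (∣X∣ D)) le)))

        small : ¬ ((2 * suc j) · C ≤ᵣ fromℕ n)
        small le =
          let (A′ , disj′) = grow fu A B (ℕ.n≤1+n j) disj (expands′ A le)
              (B′ , disj″) = grow fv B A′ ℕ.≤-refl (λ TB TA′ → disj′ TA′ TB) (expands′ B le)
          in no-disjoint-trees fu fv fuel (subst (n ≤_) (ℕ.+-suc j fuel) n≤) A′ B′
               (λ TA′ TB′ → disj″ TB′ TA′)

        large : ¬ (fromℕ n ≤ᵣ (2 * suc j) · C)
        large ge =
          let (x , y , x∈ , y∈ , xy) = joined (X A) (X B)
                (λ (z , z∈) → let (z∈A , z∈B) = x∈p∩q⁻ (X A) (X B) z∈ in disj (inj₁ z∈A) (inj₁ z∈B))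
                (subst (λ k → fromℕ n ≤ᵣ (2 * k) · C) (sym (∣X∣ A)) ge)
                (subst (λ k → fromℕ n ≤ᵣ (2 * k) · C) (sym (∣X∣ B)) ge)
          in no-crossing-edge fu disj (inj₁ x∈)
               (reach A x∈) (reach B y∈) xy

  -- Descent on the number of uncovered vertices

  module _ {C : ℝ} (3≤C : fromℕ 3 ≤ᵣ C) (expander : IsExpander G C) (2∣n : 2 ∣ n)
    (no-perfect : ¬ ∃ IsPerfect) where

    -- With no uncovered vertex the matching is perfect; with at least two, trees grown from two of
    -- them yield a matching with fewer, refuted by induction; exactly one is excluded by parity.
    no-matching : ∀ k {f} → ∣ fixed f ∣ < k → ¬ IsMatching f
    no-matching (suc k) {f} (s≤s ∣f∣≤k) mf with any? (λ u → f u ≟ u)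
    ... | no none = no-perfect (covering⇒IsPerfect mf λ x fx → none (x , fx))
    ... | yes (u , fu) with any? (λ v → (f v ≟ v) ×-dec ¬? (v ≟ u))
    ...   | yes (v , fv , v≢u) = no-disjoint-trees 3≤C expander fu fv n ℕ.≤-refl
              (root fu) (root fv) (root-disjoint fu fv (v≢u ∘ sym))
      where
      shrinks⇒⊥ : ∀ {h w} → IsMatching h → f w ≡ w → (∀ z → h z ≡ z → f z ≡ z × z ≢ w) → ⊥
      shrinks⇒⊥ mh fw shrinks = no-matching k (ℕ.<-≤-trans (∣fixed∣-< fw shrinks) ∣f∣≤k) mh
      open AlternatingTrees f mf shrinks⇒⊥
    ...   | no none = from-no (2 ∣? 1)
              (subst (2 ∣_) (trans (cong ∣_∣ fixed≡⁅u⁆) (∣⁅x⁆∣≡1 u)) (2∣∣fixed∣ 2∣n f (involutive mf)))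
      where
      fixed≡⁅u⁆ : fixed f ≡ ⁅ u ⁆
      fixed≡⁅u⁆ = ⊆-antisym (λ {z} z∈ → only z (∈-fixed⁻ f z∈) (z ≟ u))
        λ z∈ → subst (_∈ fixed f) (sym (x∈⁅y⁆⇒x≡y u z∈)) (∈-fixed⁺ f fu)
        where
        only : ∀ z → f z ≡ z → Dec (z ≡ u) → z ∈ ⁅ u ⁆
        only z fz (yes refl) = x∈⁅x⁆ u
        only z fz (no z≢u)   = contradiction (z , fz , z≢u) none

lemma4p1 : ∀ (n : ℕ) (G : Graph n) (C : ℝ) → fromℕ 3 ≤ᵣ C → IsExpander G C →
    2 ∣ n → PerfectMatching G
-- Deciding existence by finite search makes the argument by contradiction constructive.
lemma4p1 n G C 3≤C expander 2∣n with anyVec? n (isPerfect? G)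
... | yes perfect    = IsPerfect⇒PerfectMatching G perfect
... | no no-perfect = ⊥-elim
  -- The descent starts at the empty matching, the identity, which leaves all `n` vertices
  -- uncovered; the bound is strict, hence `suc n`.
  (no-matching G 3≤C expander 2∣n no-perfect (suc n) {λ x → x} (s≤s (∣p∣≤n (fixed λ x → x)))
    (record { involutive = λ _ → refl ; adjacent = λ x x≢x → contradiction refl x≢x }))
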